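{- For all $k\geq 1$, $AR_o^*(M_k) \leq \frac{k^2}{3} + \mathcal{O}(k)$; that is, there is an absolute constant $C$ such that $AR_o^*(M_k) \leq \frac{k^2}{3} + Ck$ for all $k\geq 1$, where $M_k$ is the matching with $k$ edges.
   Context: An edge-coloring (with natural numbers as colors) of a graph, possibly with parallel edges, is proper if any two distinct edges sharing an endpoint (in particular parallel edges) receive distinct colors; an edge-colored graph is rainbow if all its edges have distinct colors. A copy of $H$ is a (not necessarily induced) subgraph isomorphic to $H$. $AR_o^*(H)$ is defined by a game between Builder and Painter: Builder creates vertices and edges, one edge at a time, and is allowed to present parallel edges; immediately after each edge is built, Painter irrevocably colors it so that the coloring stays proper. Both players have complete information. $AR_o^*(H)$ is the smallest $t$ such that Builder has a strategy which, against every Painter, guarantees a rainbow copy of $H$ after at most $t$ edges have been built and colored. -}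

module Defs where

open import Data.Fin using (Fin; combine)
open import Data.Fin.Patterns using (0F; 1F)
open import Data.Fin.Properties using (combine-injectiveʳ)
open import Data.Integer using (+_; +≤+)
import Data.Integer.Properties as ℤ
open import Data.List using (List; []; _∷_; length; lookup)
open import Data.List.Relation.Unary.AllPairs using (AllPairs)
open import Data.Nat using (ℕ; zero; suc; _*_; _<_; _≤_)
open import Data.Nat.Induction using (<-rec)
open import Data.Nat.Properties using (≮⇒≥)
open import Data.Product using (Σ; ∃; ∃-syntax; _×_; _,_; proj₁; proj₂)
open import Data.Rational.Unnormalised as ℚ using (ℚᵘ; *≤*)
import Data.Rational.Unnormalised.Properties as ℚ
open import Data.Sum using (_⊎_)
open import Function.Base using (_∘_)
open import Function.Bundles using (_⇔_; mk⇔)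
open import Function.Definitions using (Injective)
open import Relation.Binary.PropositionalEquality
  using (_≡_; _≢_; subst₂; sym)
open import Relation.Nullary using (¬_)

-- A finite loopless graph, possibly with parallel edges.  The order in which
-- `ends` lists the two endpoints carries no meaning.
record Graph : Set where
  field
    order    : ℕ
    size     : ℕ
    ends     : Fin size → Fin order × Fin order
    loopless : ∀ e → proj₁ (ends e) ≢ proj₂ (ends e)

-- The vertices are the pairs (i , j) with i < k and j < 2, encoded by
-- `combine`; the i-th edge joins (i , 0) and (i , 1).
M : ℕ → Graph
M k = record
  { order    = k * 2
  ; size     = k
  ; ends     = λ i → combine i 0F , combine i 1F
  ; loopless = λ i eq → 0≢1 (combine-injectiveʳ i 0F i 1F eq)
  }
  where
  0≢1 : _≢_ {A = Fin 2} 0F 1F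
  0≢1 ()

-- Vertices are drawn from the unbounded supply ℕ, so that creating a vertex
-- needs no separate move.
record Edge : Set where
  constructor edge
  field
    left right : ℕ
    .distinct  : left ≢ right

open Edge public

_∈ᵉ_ : ℕ → Edge → Set
v ∈ᵉ e = v ≡ left e ⊎ v ≡ right e

Joins : Edge → ℕ → ℕ → Set
Joins e u v = (left e ≡ u × right e ≡ v) ⊎ (left e ≡ v × right e ≡ u)

ColouredEdge : Set
ColouredEdge = Edge × ℕ

-- The history of a play, latest edge first.  Repeated entries are parallel
-- edges.
Position : Set
Position = List ColouredEdge

edgeAt : (G : Position) → Fin (length G) → Edge
edgeAt G i = proj₁ (lookup G i)

colourAt : (G : Position) → Fin (length G) → ℕ
colourAt G i = proj₂ (lookup G i)

-- `AllPairs` ranges over pairs of distinct list positions, hence also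
-- separates parallel edges.
Proper : Position → Set
Proper = AllPairs λ (e , c) (f , d) → (∃[ v ] (v ∈ᵉ e × v ∈ᵉ f)) → c ≢ d

record Copy (H : Graph) (G : Position) : Set where
  open Graph H
  field
    onVertices           : Fin order → ℕ
    onEdges              : Fin size → Fin (length G)
    onVertices-injective : Injective _≡_ _≡_ onVertices
    onEdges-injective    : Injective _≡_ _≡_ onEdges
    incidence            : ∀ e → Joins (edgeAt G (onEdges e))
                                       (onVertices (proj₁ (ends e)))
                                       (onVertices (proj₂ (ends e)))

Rainbow : ∀ {H G} → Copy H G → Set
Rainbow {G = G} K = Injective _≡_ _≡_ (colourAt G ∘ Copy.onEdges K)

HasRainbowCopy : Graph → Position → Set
HasRainbowCopy H G = Σ (Copy H G) Rainbow

Builder : Set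
Builder = Position → Edge

record Painter : Set where
  field
    colour : Position → Edge → ℕ
    legal  : ∀ {G} → Proper G → ∀ e → Proper ((e , colour G e) ∷ G)

play : Builder → Painter → ℕ → Position
play β π zero    = []
play β π (suc n) = (β G , Painter.colour π G (β G)) ∷ G
  where G = play β π n

CanForce : Graph → ℕ → Set
CanForce H t =
  ∃[ β ] ((π : Painter) → ∃[ n ] (n ≤ t × HasRainbowCopy H (play β π n)))

record IsAR* (H : Graph) (t : ℕ) : Set where
  field
    forces : CanForce H t
    least  : ∀ {s} → CanForce H s → t ≤ s

fromℕ : ℕ → ℚᵘ
fromℕ n = + n ℚ./ 1

-- "The least t with CanForce H t is at most q", phrased so as not to presuppose
-- that the least t can be computed; see the two lemmas below.
AR*[_]≤_ : Graph → ℚᵘ → Set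
AR*[ H ]≤ q = ∃[ t ] (CanForce H t × fromℕ t ℚ.≤ q)

infix 4 AR*[_]≤_

fromℕ-mono-≤ : ∀ {m n} → m ≤ n → fromℕ m ℚ.≤ fromℕ n
fromℕ-mono-≤ {m} {n} m≤n =
  *≤* (subst₂ Data.Integer._≤_ (sym (ℤ.*-identityʳ (+ m)))
                               (sym (ℤ.*-identityʳ (+ n))) (+≤+ m≤n))

AR*≤⇔ : ∀ {H t q} → IsAR* H t → AR*[ H ]≤ q ⇔ fromℕ t ℚ.≤ q
AR*≤⇔ {t = t} isAR = mk⇔
  (λ (s , fs , s≤q) → ℚ.≤-trans (fromℕ-mono-≤ (IsAR*.least isAR fs)) s≤q)
  (λ t≤q → t , IsAR*.forces isAR , t≤q)

AR*≤⇒¬¬∃ : ∀ {H q} → AR*[ H ]≤ q → ¬ ¬ ∃ (IsAR* H)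
AR*≤⇒¬¬∃ {H} (t , ft , _) none = <-rec (λ s → ¬ CanForce H s) step t ft
  where
  step : ∀ s → (∀ {r} → r < s → ¬ CanForce H r) → ¬ CanForce H s
  step s below fs = none (s , record
    { forces = fs ; least = λ fr → ≮⇒≥ λ r<s → below r<s fr })

{-# OPTIONS --safe #-}
module Submission where

-- Let the colours of a rainbow matching of size m be "old", and let
-- N, N+1, N+2, N+3 be new vertices.  Builder presents about 2m/3 parallel edges
-- {N+1, N+2}.  If one of them gets a new colour, the matching has grown at the
-- cost of at most 2m/3 edges.  Otherwise these old colours are blocked at both
-- N+1 and N+2, so about m/3 parallel edges {N, N+1} force a new colour, and then
-- about m/3 parallel edges {N+2, N+3} force a second one: the matching grows by
-- two at the cost of about 4m/3 edges.  Either way an additional matching edge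
-- costs 2m/3 + O(1), and summing over m < k gives k²/3 + O(k).

open import Defs
open import Data.Empty using (⊥-elim-irr)
open import Data.Fin using (Fin; zero; suc; inject≤; remQuot; combine)
import Data.Fin.Properties as Fin
open import Data.Fin.Patterns using (0F; 1F)
open import Data.Integer as ℤ using (+_; +≤+)
import Data.Integer.Properties as ℤ
open import Data.List using (List; []; _∷_; _++_; length; lookup; map; reverse; _ʳ++_)
open import Data.List.Properties
  using (length-++; length-map; ʳ++-defn; ++-identityʳ; reverse-involutive)
open import Data.Nat as ℕ using (ℕ; zero; suc; _≥_; _^_; _≤_; _<_; z≤n; s≤s)
open import Data.List.Membership.DecPropositional ℕ._≟_ using (_∈?_)
open import Data.List.Membership.Propositional using (_∈_; _∉_)
open import Data.List.Membership.Propositional.Properties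
  using (∈-++⁺ˡ; ∈-++⁺ʳ; ∈-++⁻; ∈-map⁺; ∈-lookup)
open import Data.List.Relation.Binary.Sublist.Propositional as Sublist using ([]; _∷_; _∷ʳ_)
import Data.List.Relation.Binary.Sublist.Propositional.Properties as Sublist
open import Data.List.Relation.Unary.All as All using (All; []; _∷_)
import Data.List.Relation.Unary.All.Properties as All
open import Data.List.Relation.Unary.AllPairs as AllPairs using (AllPairs; []; _∷_)
import Data.List.Relation.Unary.AllPairs.Properties as AllPairs
open import Data.List.Relation.Unary.Any as Any using (there)
import Data.List.Relation.Unary.Any.Properties as Any
open import Data.List.Relation.Unary.Unique.Propositional using (Unique)
import Data.Nat.Properties as ℕ
open import Data.Nat.Tactic.RingSolver using (solve-∀)
open import Data.Product using (∃; ∃₂; ∃-syntax; _×_; _,_; proj₁; proj₂; uncurry)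
open import Data.Rational.Unnormalised as ℚ using (ℚᵘ; _/_; _+_; _*_; *≤*)
open import Data.Sum using (inj₁; inj₂; [_,_]′)
open import Function.Base using (_∘_; _on_)
open import Function.Definitions using (Injective)
open import Level using (0ℓ)
open import Relation.Binary.Core using (Rel)
open import Relation.Binary.Definitions using (Decidable; Symmetric)
open import Relation.Binary.PropositionalEquality
open import Relation.Nullary using (¬_; Dec; yes; no; contradiction; ¬?)
open import Relation.Nullary.Decidable using (map′; _⊎-dec_; _→-dec_; decidable-stable)

-- Pairwise relations on lists and the pigeonhole principle.

AllPairs-lookup : ∀ {A : Set} {R : Rel A 0ℓ} {xs : List A} → Symmetric R →
                  AllPairs R xs → ∀ {i j} → i ≢ j → R (lookup xs i) (lookup xs j)
AllPairs-lookup sym′ (r ∷ rs) {zero}  {zero}  i≢j = contradiction refl i≢j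
AllPairs-lookup sym′ (r ∷ rs) {zero}  {suc j} i≢j = All.lookup r (∈-lookup j)
AllPairs-lookup sym′ (r ∷ rs) {suc i} {zero}  i≢j = sym′ (All.lookup r (∈-lookup i))
AllPairs-lookup sym′ (r ∷ rs) {suc i} {suc j} i≢j =
  AllPairs-lookup sym′ rs (i≢j ∘ cong suc)

AllPairs-resp-⊆ : ∀ {A : Set} {R : Rel A 0ℓ} {xs ys : List A} →
                  xs Sublist.⊆ ys → AllPairs R ys → AllPairs R xs
AllPairs-resp-⊆ []             []       = []
AllPairs-resp-⊆ (_    ∷ʳ xs⊆ys) (_ ∷ rs) = AllPairs-resp-⊆ xs⊆ys rs
AllPairs-resp-⊆ (refl ∷  xs⊆ys) (r ∷ rs) =
  Sublist.All-resp-⊆ xs⊆ys r ∷ AllPairs-resp-⊆ xs⊆ys rs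

-- If `xs` were longer, two of its entries would be found at the same index of `ys`, hence be equal.
Unique-⊆⇒length-≤ : ∀ {A : Set} {xs ys : List A} →
                    Unique xs → All (_∈ ys) xs → length xs ≤ length ys
Unique-⊆⇒length-≤ {xs = xs} {ys} xs! xs⊆ys = ℕ.≮⇒≥ λ ys<xs →
  let i , j , i<j , eq = Fin.pigeonhole ys<xs (Any.index ∘ position)
  in AllPairs-lookup ≢-sym xs! (Fin.<⇒≢ i<j)
       (trans (Any.lookup-index (position i))
              (trans (cong (lookup ys) eq) (sym (Any.lookup-index (position j)))))
  where
  position : ∀ i → lookup xs i ∈ ys
  position i = All.lookup xs⊆ys (∈-lookup i)

-- Game trees and Builder's strategies.

_∈ᵉ?_ : Decidable _∈ᵉ_
v ∈ᵉ? e = v ℕ.≟ left e ⊎-dec v ℕ.≟ right e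

meet? : ∀ e f → Dec (∃[ v ] (v ∈ᵉ e × v ∈ᵉ f))
meet? e f = map′
  [ (λ p → left e , inj₁ refl , p) , (λ p → right e , inj₂ refl , p) ]′
  (λ { (_ , inj₁ refl , p) → inj₁ p ; (_ , inj₂ refl , p) → inj₂ p })
  (left e ∈ᵉ? f ⊎-dec right e ∈ᵉ? f)

proper? : ∀ G → Dec (Proper G)
proper? = AllPairs.allPairs? λ (e , c) (f , d) → meet? e f →-dec ¬? (c ℕ.≟ d)

-- A game tree that branches over the colour of each edge and mentions no Painter, so that moves can
-- be planned locally. Only proper replies must be answered.
data Winning (H : Graph) : ℕ → Position → Set where
  done : ∀ {t G} → HasRainbowCopy H G → Winning H t G
  move : ∀ {t G} e → (∀ c → Proper ((e , c) ∷ G) → Winning H t ((e , c) ∷ G)) →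
         Winning H (suc t) G

link : ℕ → Edge
link v = edge v (suc v) (≢-sym ℕ.1+n≢n)

-- Builder's next edge after the moves `h`, earliest first.  The value `link 0`
-- is only returned once the game is won, or on histories that cannot arise.
follow : ∀ {H t G} → Winning H t G → Position → Edge
follow (done _) h = link 0
follow (move e f) [] = e
-- Only the colour is read from the history. The subtree `f c` wants a proof of properness, so
-- properness is decided here.
follow {G = G} (move e f) ((_ , c) ∷ h) with proper? ((e , c) ∷ G)
... | yes p = follow (f c p) h
... | no  _ = link 0

-- Induction on the tree. The invariant is that `β` plays the subtree `w` from `G` on, whatever
-- moves `h` follow.
follow-wins : ∀ {H t G} (w : Winning H t G) (β : Builder) (π : Painter) n →
              play β π n ≡ G → Proper G → (∀ h → β (h ʳ++ G) ≡ follow w h) →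
              ∃[ n′ ] (n′ ≤ n ℕ.+ t × HasRainbowCopy H (play β π n′))
follow-wins (done K) β π n refl _ _ = n , ℕ.m≤m+n n _ , K
follow-wins {t = suc t} {G} (move e f) β π n refl proper agrees
  with proper? ((e , Painter.colour π G e) ∷ G)
     -- Abstracted together with the decision so that `follow` computes in its type.
     | (λ h → agrees ((e , Painter.colour π G e) ∷ h))
... | no ¬p | _ = contradiction (Painter.legal π proper e) ¬p
... | yes p | agrees′ =
  let n′ , n′≤ , K = follow-wins (f _ p) β π (suc n)
                       (cong (λ e′ → (e′ , Painter.colour π G e′) ∷ G) (agrees []))
                       p agrees′
  in n′ , subst (n′ ≤_) (sym (ℕ.+-suc n t)) n′≤ , K

winning⇒canForce : ∀ {H t} → Winning H t [] → CanForce H t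
winning⇒canForce w = (follow w ∘ reverse) , λ π →
  follow-wins w _ π 0 refl [] λ h →
    cong (follow w) (trans (cong reverse (trans (ʳ++-defn h) (++-identityʳ _)))
                           (reverse-involutive h))

-- Blocks of parallel edges and new colours.

Parallel : Edge → List ColouredEdge → Set
Parallel e = All ((_≡ e) ∘ proj₁)

-- The whole block is presented whatever Painter replies; Builder inspects the colours only
-- afterwards.
present : ∀ {H t G} e n →
          (∀ B → Parallel e B → length B ≡ n → Proper (B ++ G) → Winning H t (B ++ G)) →
          Proper G → Winning H (n ℕ.+ t) G
present {H} {t} {G} e n win proper = go n [] [] (ℕ.+-identityʳ n) proper
  where
  go : ∀ i B → Parallel e B → i ℕ.+ length B ≡ n → Proper (B ++ G) →
       Winning H (i ℕ.+ t) (B ++ G)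
  go zero    B par len proper = win B par len proper
  go (suc i) B par len proper = move e λ c →
    go i ((e , c) ∷ B) (refl ∷ par) (trans (ℕ.+-suc i _) len)

colours : List ColouredEdge → List ℕ
colours = map proj₂

-- Pairwise intersecting edges of a proper position have distinct colours, so
-- more than `length L` of them cannot all repeat colours of `L`.
newColour : ∀ {G} v (T L : List ColouredEdge) → Proper G → T Sublist.⊆ G →
            All ((v ∈ᵉ_) ∘ proj₁) T → length L < length T →
            ∃[ b ] (b ∈ T × proj₂ b ∉ colours L)
newColour v T L proper T⊆G star L<T with Any.any? (λ b → ¬? (proj₂ b ∈? colours L)) T
... | yes p = Any.lookup p , ∈-lookup (Any.index p) , Any.lookup-result p
... | no ¬p = contradiction
  (subst₂ _≤_ (length-map proj₂ T) (length-map proj₂ L)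
    (Unique-⊆⇒length-≤ (AllPairs.map⁺ (distinct′ star (AllPairs-resp-⊆ T⊆G proper)))
      (All.map⁺ (All.map (decidable-stable (_ ∈? _)) (All.¬Any⇒All¬ T ¬p)))))
  (ℕ.<⇒≱ L<T)
  where
  distinct′ : ∀ {T} → All ((v ∈ᵉ_) ∘ proj₁) T → Proper T → AllPairs (_≢_ on proj₂) T
  distinct′ []       []       = []
  distinct′ (v∈e ∷ vs) (r ∷ rs) =
    All.zipWith (λ (v∈f , c≢d) → c≢d (v , v∈e , v∈f)) (vs , r) ∷ distinct′ vs rs

-- Rainbow matchings and copies of `M k`.

Separate : Rel ColouredEdge 0ℓ
Separate (e , c) (f , d) = (∀ v → v ∈ᵉ e → ¬ v ∈ᵉ f) × c ≢ d

Separate-sym : Symmetric Separate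
Separate-sym (disj , c≢d) = (λ v v∈f v∈e → disj v v∈e v∈f) , ≢-sym c≢d

-- `N` bounds the vertices of the matching alone, so an edge on vertices from `N` on cannot touch
-- it.
record RainbowMatching (G : Position) (N : ℕ) (L : List ColouredEdge) : Set where
  field
    present! : All (_∈ G) L
    separate : AllPairs Separate L
    bounded  : All (λ b → ∀ v → v ∈ᵉ proj₁ b → v < N) L

open RainbowMatching

grow : ∀ {G N L} B → RainbowMatching G N L → RainbowMatching (B ++ G) N L
grow B R = record
  { present! = All.map (∈-++⁺ʳ B) (present! R)
  ; separate = separate R
  ; bounded  = bounded R
  }

add : ∀ {G N L v b} → RainbowMatching G N L → N ≤ v → b ∈ G → proj₁ b ≡ link v →
      proj₂ b ∉ colours L → RainbowMatching G (2 ℕ.+ v) (b ∷ L)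
add {N = N} {L} {v} {b} R N≤v b∈G refl fresh = record
  { present! = b∈G ∷ present! R
  ; separate = All.tabulate apart ∷ separate R
  ; bounded  = (λ { _ (inj₁ refl) → ℕ.m<n⇒m<1+n ℕ.≤-refl ; _ (inj₂ refl) → ℕ.≤-refl })
             ∷ All.map (λ below u u∈ → ℕ.<-≤-trans (below u u∈) (ℕ.m≤n⇒m≤o+n 2 N≤v)) (bounded R)
  }
  where
  v≤ : ∀ u → u ∈ᵉ link v → v ≤ u
  v≤ _ (inj₁ refl) = ℕ.≤-refl
  v≤ _ (inj₂ refl) = ℕ.n≤1+n v

  apart : ∀ {f} → f ∈ L → Separate b f
  apart f∈L =
    (λ u u∈e u∈f → ℕ.<⇒≱ (All.lookup (bounded R) f∈L u u∈f) (ℕ.≤-trans N≤v (v≤ u u∈e))) ,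
    (λ eq → fresh (subst (_∈ colours L) (sym eq) (∈-map⁺ proj₂ f∈L)))

matching⇒copy : ∀ {G N L k} → RainbowMatching G N L → k ≤ length L → HasRainbowCopy (M k) G
matching⇒copy {G} {N} {L} {k} R k≤L = record
  { onVertices           = vertex
  ; onEdges              = place
  ; onVertices-injective = vertex-injective
  -- A position determines its colour, so distinct colours force distinct positions.
  ; onEdges-injective    = λ eq → rainbow (cong (colourAt G) eq)
  ; incidence            = joins
  } , rainbow
  where
  nth : Fin k → ColouredEdge
  -- Only the first `k` entries: the last round may overshoot.
  nth i = lookup L (inject≤ i k≤L)

  nth∈G : ∀ i → nth i ∈ G
  nth∈G i = All.lookup (present! R) (∈-lookup (inject≤ i k≤L))

  place : Fin k → Fin (length G)
  place i = Any.index (nth∈G i)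

  nth-place : ∀ i → nth i ≡ lookup G (place i)
  nth-place i = Any.lookup-index (nth∈G i)

  apart : ∀ {i j} → i ≢ j → Separate (nth i) (nth j)
  apart i≢j = AllPairs-lookup (λ {x} {y} → Separate-sym {x} {y}) (separate R)
    (i≢j ∘ Fin.inject≤-injective k≤L k≤L _ _)

  rainbow : Injective _≡_ _≡_ (colourAt G ∘ place)
  rainbow {i} {j} eq = decidable-stable (i Fin.≟ j) λ i≢j →
    proj₂ (apart i≢j)
      (trans (cong proj₂ (nth-place i)) (trans eq (sym (cong proj₂ (nth-place j)))))

  end : Fin k × Fin 2 → ℕ
  end (i , 0F) = left  (proj₁ (nth i))
  end (i , 1F) = right (proj₁ (nth i))

  end∈ : ∀ i s → end (i , s) ∈ᵉ proj₁ (nth i)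
  end∈ i 0F = inj₁ refl
  end∈ i 1F = inj₂ refl

  left≢right : ∀ e → left e ≢ right e
  left≢right (edge l r l≢r) eq = ⊥-elim-irr (l≢r eq)

  end-injective : Injective _≡_ _≡_ end
  end-injective {i , s} {j , s′} eq with i Fin.≟ j
  ... | no i≢j = contradiction (subst (_∈ᵉ proj₁ (nth j)) (sym eq) (end∈ j s′))
                   (proj₁ (apart i≢j) _ (end∈ i s))
  end-injective {i , 0F} {i , 0F} eq | yes refl = refl
  end-injective {i , 0F} {i , 1F} eq | yes refl = contradiction eq (left≢right (proj₁ (nth i)))
  end-injective {i , 1F} {i , 0F} eq | yes refl = contradiction (sym eq) (left≢right (proj₁ (nth i)))
  end-injective {i , 1F} {i , 1F} eq | yes refl = refl

  vertex : Fin (k ℕ.* 2) → ℕ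
  vertex = end ∘ remQuot 2

  vertex-injective : Injective _≡_ _≡_ vertex
  vertex-injective {x} {y} eq =
    trans (sym (Fin.combine-remQuot {k} 2 x))
      (trans (cong (uncurry combine) (end-injective eq)) (Fin.combine-remQuot {k} 2 y))

  joins : ∀ i → Joins (edgeAt G (place i)) (vertex (combine i 0F)) (vertex (combine i 1F))
  joins i rewrite Fin.remQuot-combine {k} {2} i 0F | Fin.remQuot-combine {k} {2} i 1F
                | sym (nth-place i) = inj₁ (refl , refl)

-- Arithmetic of the edge budget.

split-thirds : ∀ m → ∃₂ λ r q → r ℕ.+ q ≡ m × 3 ℕ.* r ≤ 2 ℕ.* m × 3 ℕ.* q ≤ m ℕ.+ 2
-- `r` is 2m/3 rounded down, the size of the first block; `q` is m/3 rounded up, the number of old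
-- colours this block leaves unblocked.
split-thirds 0 = 0 , 0 , refl , z≤n , z≤n
split-thirds 1 = 0 , 1 , refl , z≤n , ℕ.≤-refl
split-thirds 2 = 1 , 1 , refl , ℕ.n≤1+n 3 , ℕ.n≤1+n 3
split-thirds (suc (suc (suc m))) =
  let r , q , r+q≡m , 3r≤ , 3q≤ = split-thirds m in
  2 ℕ.+ r , suc q
  , trans (cong (2 ℕ.+_) (ℕ.+-suc r q)) (cong (3 ℕ.+_) r+q≡m)
  , subst₂ _≤_ (eq₁ r) (eq₂ m) (ℕ.+-monoʳ-≤ 6 3r≤)
  , subst (_≤ 3 ℕ.+ m ℕ.+ 2) (eq₃ q) (ℕ.+-monoʳ-≤ 3 3q≤)
  where
  eq₁ : ∀ r → 6 ℕ.+ 3 ℕ.* r ≡ 3 ℕ.* (2 ℕ.+ r)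
  eq₁ = solve-∀
  eq₂ : ∀ m → 6 ℕ.+ 2 ℕ.* m ≡ 2 ℕ.* (3 ℕ.+ m)
  eq₂ = solve-∀
  eq₃ : ∀ q → 3 ℕ.+ 3 ℕ.* q ≡ 3 ℕ.* suc q
  eq₃ = solve-∀

-- Three times the edge budget for reaching a matching of size m; the factor 3
-- avoids fractions, and the linear term pays for the rounding in each round.
potential : ℕ → ℕ
potential m = m ℕ.* m ℕ.+ 6 ℕ.* m

potential-mono : ∀ {m n} → m ≤ n → potential m ≤ potential n
potential-mono m≤n = ℕ.+-mono-≤ (ℕ.*-mono-≤ m≤n m≤n) (ℕ.*-monoʳ-≤ 6 m≤n)

-- The target is `suc k` rather than k because the last round may overshoot by
-- one.
record Affords (k m t : ℕ) : Set where
  constructor affords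
  field
    reaches : potential (suc k) ≤ 3 ℕ.* t ℕ.+ potential m

-- The `c` edges spent are paid for by the increase `s` of the potential when the matching gains `d`
-- edges.
affords-step : ∀ {k m d t s} c → 3 ℕ.* c ≤ s → potential (d ℕ.+ m) ≡ s ℕ.+ potential m →
               Affords k m (c ℕ.+ t) → Affords k (d ℕ.+ m) t
affords-step {k} {m} {d} {t} {s} c 3c≤s eq (affords aff) = affords (begin
  potential (suc k)                        ≤⟨ aff ⟩
  3 ℕ.* (c ℕ.+ t) ℕ.+ potential m          ≡⟨ rearrange c t (potential m) ⟩
  3 ℕ.* t ℕ.+ (3 ℕ.* c ℕ.+ potential m)    ≤⟨ ℕ.+-monoʳ-≤ (3 ℕ.* t) (ℕ.+-monoˡ-≤ _ 3c≤s) ⟩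
  3 ℕ.* t ℕ.+ (s ℕ.+ potential m)          ≡⟨ cong (3 ℕ.* t ℕ.+_) eq ⟨
  3 ℕ.* t ℕ.+ potential (d ℕ.+ m)          ∎)
  where
  open ℕ.≤-Reasoning
  rearrange : ∀ c t p → 3 ℕ.* (c ℕ.+ t) ℕ.+ p ≡ 3 ℕ.* t ℕ.+ (3 ℕ.* c ℕ.+ p)
  rearrange = solve-∀

potential-1 : ∀ m → potential (1 ℕ.+ m) ≡ (2 ℕ.* m ℕ.+ 7) ℕ.+ potential m
potential-1 = solve′
  where
  solve′ : ∀ m → (1 ℕ.+ m) ℕ.* (1 ℕ.+ m) ℕ.+ 6 ℕ.* (1 ℕ.+ m)
               ≡ (2 ℕ.* m ℕ.+ 7) ℕ.+ (m ℕ.* m ℕ.+ 6 ℕ.* m)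
  solve′ = solve-∀

potential-2 : ∀ m → potential (2 ℕ.+ m) ≡ (4 ℕ.* m ℕ.+ 16) ℕ.+ potential m
potential-2 = solve′
  where
  solve′ : ∀ m → (2 ℕ.+ m) ℕ.* (2 ℕ.+ m) ℕ.+ 6 ℕ.* (2 ℕ.+ m)
               ≡ (4 ℕ.* m ℕ.+ 16) ℕ.+ (m ℕ.* m ℕ.+ 6 ℕ.* m)
  solve′ = solve-∀

-- The three blocks of parallel edges {N+1, N+2}, {N, N+1}, {N+2, N+3}.
round : ℕ → ℕ → ℕ
round r q = r ℕ.+ (suc q ℕ.+ suc (suc q))

round-cost : ∀ {m} r q → r ℕ.+ q ≡ m → 3 ℕ.* q ≤ m ℕ.+ 2 → 3 ℕ.* round r q ≤ 4 ℕ.* m ℕ.+ 16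
round-cost {m} r q refl 3q≤ = begin
  3 ℕ.* round r q                 ≡⟨ eq₁ r q ⟩
  3 ℕ.* (r ℕ.+ q) ℕ.+ 9 ℕ.+ 3 ℕ.* q  ≤⟨ ℕ.+-monoʳ-≤ (3 ℕ.* m ℕ.+ 9) 3q≤ ⟩
  -- The cost is 4m + 11; adding 5 reaches the increase 4m + 16 of the potential for two edges.
  3 ℕ.* m ℕ.+ 9 ℕ.+ (m ℕ.+ 2)     ≤⟨ ℕ.m≤m+n _ 5 ⟩
  3 ℕ.* m ℕ.+ 9 ℕ.+ (m ℕ.+ 2) ℕ.+ 5 ≡⟨ eq₂ m ⟩
  4 ℕ.* m ℕ.+ 16                  ∎
  where
  open ℕ.≤-Reasoning
  eq₁ : ∀ r q → 3 ℕ.* (r ℕ.+ ((1 ℕ.+ q) ℕ.+ (2 ℕ.+ q))) ≡ 3 ℕ.* (r ℕ.+ q) ℕ.+ 9 ℕ.+ 3 ℕ.* q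
  eq₁ = solve-∀
  eq₂ : ∀ m → 3 ℕ.* m ℕ.+ 9 ℕ.+ (m ℕ.+ 2) ℕ.+ 5 ≡ 4 ℕ.* m ℕ.+ 16
  eq₂ = solve-∀

-- For m < k the target `potential (suc k)` is at least `potential (2 + m)`, so the remaining budget
-- covers a whole round.
affordable : ∀ {k m t} c → 3 ℕ.* c ≤ 4 ℕ.* m ℕ.+ 16 → m < k →
             Affords k m t → ∃[ t′ ] c ℕ.+ t′ ≡ t
affordable {k} {m} {t} c 3c≤ m<k (affords aff) = ℕ.m≤n⇒∃[o]m+o≡n (ℕ.*-cancelˡ-≤ 3 (begin
  3 ℕ.* c         ≤⟨ 3c≤ ⟩
  4 ℕ.* m ℕ.+ 16  ≤⟨ ℕ.+-cancelʳ-≤ (potential m) _ _ (begin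
    4 ℕ.* m ℕ.+ 16 ℕ.+ potential m ≡⟨ potential-2 m ⟨
    potential (2 ℕ.+ m)            ≤⟨ potential-mono (s≤s m<k) ⟩
    potential (suc k)              ≤⟨ aff ⟩
    3 ℕ.* t ℕ.+ potential m        ∎) ⟩
  3 ℕ.* t         ∎))
  where open ℕ.≤-Reasoning

-- A round of the strategy and its iteration.

∈-new : ∀ {b : ColouredEdge} {L L′} B {P} → (∀ {c} → c ∈ colours L → c ∈ colours L′) →
        All ((_∈ colours L) ∘ proj₂) P → b ∈ B ++ P → proj₂ b ∉ colours L′ → b ∈ B
∈-new B L⊆L′ old b∈ new with ∈-++⁻ B b∈
... | inj₁ b∈B = b∈B
-- The edges of `P` repeat colours of `L`, so the new colour must occur in `B`.
... | inj₂ b∈P = contradiction (L⊆L′ (All.lookup old b∈P)) new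

star : ∀ {v e B} → v ∈ᵉ e → Parallel e B → All ((v ∈ᵉ_) ∘ proj₁) B
star v∈e = All.map λ { refl → v∈e }

-- `one` and `two` continue after a gain of one or two edges. If the first block already brings a
-- gain, the budget of the other two blocks is left for `one`.
grow-matching :
  ∀ {H G N L t} r q → r ℕ.+ q ≡ length L → RainbowMatching G N L → Proper G →
  (∀ {G′ N′ b} → RainbowMatching G′ N′ (b ∷ L) → Proper G′ →
     Winning H (suc q ℕ.+ (suc (suc q) ℕ.+ t)) G′) →
  (∀ {G′ N′ a b} → RainbowMatching G′ N′ (b ∷ a ∷ L) → Proper G′ → Winning H t G′) →
  Winning H (r ℕ.+ (suc q ℕ.+ (suc (suc q) ℕ.+ t))) G
grow-matching {H} {G} {N} {L} {t} r q r+q≡m R proper one two =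
  present (link (suc N)) r first proper
  where
  first : ∀ P → Parallel (link (suc N)) P → length P ≡ r → Proper (P ++ G) →
          Winning H (suc q ℕ.+ (suc (suc q) ℕ.+ t)) (P ++ G)
  first P parP lenP properP with Any.any? (λ b → ¬? (proj₂ b ∈? colours L)) P
  ... | yes new =
    one (add (grow P R) (ℕ.n≤1+n N) (∈-++⁺ˡ b∈P) (All.lookup parP b∈P) (Any.lookup-result new))
        properP
    where
    b∈P : Any.lookup new ∈ P
    b∈P = ∈-lookup (Any.index new)
  ... | no ¬new = present (link N) (suc q) second properP
    where
    old : All ((_∈ colours L) ∘ proj₂) P
    old = All.map (decidable-stable (_ ∈? _)) (All.¬Any⇒All¬ P ¬new)

    length-block : ∀ {n} B → length B ≡ n ℕ.+ q → length (B ++ P) ≡ n ℕ.+ length L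
    length-block {n} B lenB = begin
      length (B ++ P)        ≡⟨ length-++ B ⟩
      length B ℕ.+ length P  ≡⟨ cong₂ ℕ._+_ lenB lenP ⟩
      n ℕ.+ q ℕ.+ r          ≡⟨ ℕ.+-assoc n q r ⟩
      n ℕ.+ (q ℕ.+ r)        ≡⟨ cong (n ℕ.+_) (trans (ℕ.+-comm q r) r+q≡m) ⟩
      n ℕ.+ length L         ∎
      where open ≡-Reasoning

    second : ∀ A → Parallel (link N) A → length A ≡ suc q → Proper (A ++ P ++ G) →
             Winning H (suc (suc q) ℕ.+ t) (A ++ P ++ G)
    second A parA lenA properA
      -- With m = `length L`, there are q + 1 + r = m + 1 edges at N+1 against the m colours of `L`.
      with newColour (suc N) (A ++ P) L properA
             (Sublist.++⁺ (Sublist.⊆-refl {x = A}) (Sublist.++⁺ʳ G Sublist.⊆-refl))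
             (All.++⁺ (star (inj₂ refl) parA) (star (inj₁ refl) parP))
             (ℕ.≤-reflexive (sym (length-block {1} A lenA)))
    ... | a , a∈ , newA = present (link (2 ℕ.+ N)) (suc (suc q)) third properA
      where
      a∈A : a ∈ A
      a∈A = ∈-new A (λ c∈ → c∈) old a∈ newA

      third : ∀ B → Parallel (link (2 ℕ.+ N)) B → length B ≡ suc (suc q) →
              Proper (B ++ A ++ P ++ G) → Winning H t (B ++ A ++ P ++ G)
      third B parB lenB properB
        -- There are q + 2 + r = m + 2 edges at N+2. The colour of `a` must now be avoided too, so
        -- this block is one edge longer.
        with newColour (2 ℕ.+ N) (B ++ P) (a ∷ L) properB
               (Sublist.++⁺ (Sublist.⊆-refl {x = B})
                 (Sublist.++⁺ˡ A (Sublist.++⁺ʳ G Sublist.⊆-refl)))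
               (All.++⁺ (star (inj₁ refl) parB) (star (inj₂ refl) parP))
               (ℕ.≤-reflexive (sym (length-block {2} B lenB)))
      ... | b , b∈ , newB = two
        -- {N, N+1} and {N+2, N+3} are disjoint; the edges {N+1, N+2} served only to block colours.
        (add (grow B (add (grow A (grow P R)) ℕ.≤-refl (∈-++⁺ˡ a∈A) (All.lookup parA a∈A) newA))
             ℕ.≤-refl (∈-++⁺ˡ b∈B) (All.lookup parB b∈B) newB)
        properB
        where
        b∈B : b ∈ B
        b∈B = ∈-new {L′ = a ∷ L} B there old b∈ newB

-- `j` bounds the rounds left and makes the recursion structural: every round gains at least one
-- edge.
force : ∀ {k} j {G N L t} → k ≤ j ℕ.+ length L → RainbowMatching G N L → Proper G →
        Affords k (length L) t → Winning (M k) t G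
force zero k≤ R proper aff = done (matching⇒copy R k≤)
force {k} (suc j) {G} {N} {L} {t} k≤ R proper aff with length L ℕ.<? k
... | no ¬m<k = done (matching⇒copy R (ℕ.≮⇒≥ ¬m<k))
... | yes m<k =
  let m = length L
      r , q , r+q≡m , 3r≤ , 3q≤ = split-thirds m
      3c≤ = round-cost r q r+q≡m 3q≤
      t′ , eq = affordable (round r q) 3c≤ m<k aff
      budget : r ℕ.+ (suc q ℕ.+ (suc (suc q) ℕ.+ t′)) ≡ t
      budget = trans (cong (r ℕ.+_) (sym (ℕ.+-assoc (suc q) (suc (suc q)) t′)))
                     (trans (sym (ℕ.+-assoc r _ t′)) eq)
      k≤₁ : k ≤ j ℕ.+ suc m
      k≤₁ = subst (k ≤_) (sym (ℕ.+-suc j m)) k≤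
  in subst (λ t → Winning (M k) t G) budget (grow-matching r q r+q≡m R proper
    (λ R′ proper′ → force j k≤₁ R′ proper′
      (affords-step r (ℕ.≤-trans 3r≤ (ℕ.m≤m+n _ 7)) (potential-1 m)
        (subst (Affords k m) (sym budget) aff)))
    (λ R′ proper′ → force j (ℕ.≤-trans k≤₁ (ℕ.+-monoʳ-≤ j (ℕ.n≤1+n _))) R′ proper′
      (affords-step (round r q) 3c≤ (potential-2 m)
        (subst (Affords k m) (sym eq) aff))))

-- The bound over the rationals.

ceiling-third : ∀ n → ∃[ t ] (n ≤ 3 ℕ.* t × 3 ℕ.* t ≤ n ℕ.+ 2)
ceiling-third n with split-thirds n
... | r , q , refl , 3r≤ , 3q≤ = q , ℕ.+-cancelˡ-≤ (2 ℕ.* n) _ _ (begin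
  2 ℕ.* n ℕ.+ n        ≡⟨ eq r q ⟩
  3 ℕ.* r ℕ.+ 3 ℕ.* q  ≤⟨ ℕ.+-monoˡ-≤ (3 ℕ.* q) 3r≤ ⟩
  2 ℕ.* n ℕ.+ 3 ℕ.* q  ∎) , 3q≤
  where
  open ℕ.≤-Reasoning
  eq : ∀ r q → 2 ℕ.* (r ℕ.+ q) ℕ.+ (r ℕ.+ q) ≡ 3 ℕ.* r ℕ.+ 3 ℕ.* q
  eq = solve-∀

fromℕ-≤-bound : ∀ {t} k c → 3 ℕ.* t ≤ k ^ 2 ℕ.+ 3 ℕ.* (c ℕ.* k) →
                fromℕ t ℚ.≤ (+ (k ^ 2) / 3) + (+ c / 1) * fromℕ k
fromℕ-≤-bound {t} k c 3t≤ = *≤* (subst₂ ℤ._≤_ lhs rhs (+≤+ 3t≤))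
  where
  lhs : + (3 ℕ.* t) ≡ + t ℤ.* + 3
  lhs = trans (cong +_ (ℕ.*-comm 3 t)) (ℤ.pos-* t 3)

  rhs : + (k ^ 2 ℕ.+ 3 ℕ.* (c ℕ.* k)) ≡
        (+ (k ^ 2) ℤ.* + 1 ℤ.+ (+ c ℤ.* + k) ℤ.* + 3) ℤ.* + 1
  rhs = sym (begin
    (+ (k ^ 2) ℤ.* + 1 ℤ.+ (+ c ℤ.* + k) ℤ.* + 3) ℤ.* + 1  ≡⟨ ℤ.*-identityʳ _ ⟩
    + (k ^ 2) ℤ.* + 1 ℤ.+ (+ c ℤ.* + k) ℤ.* + 3
      ≡⟨ cong₂ ℤ._+_ (ℤ.*-identityʳ (+ (k ^ 2))) (cong (ℤ._* + 3) (sym (ℤ.pos-* c k))) ⟩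
    + (k ^ 2) ℤ.+ + (c ℕ.* k) ℤ.* + 3
      ≡⟨ cong (λ i → + (k ^ 2) ℤ.+ i) (trans (ℤ.*-comm (+ (c ℕ.* k)) (+ 3)) (sym (ℤ.pos-* 3 (c ℕ.* k)))) ⟩
    + (k ^ 2) ℤ.+ + (3 ℕ.* (c ℕ.* k))                       ∎)
    where open ≡-Reasoning

theorem18 : ∃ λ (C : ℚᵘ) → ((k : ℕ) → k ≥ 1 → AR*[ M k ]≤ (+ (k ^ 2) / 3) + C * fromℕ k)
-- Three times the budget is at most `potential (suc k) + 2`, which is k² + 8k + 9, hence at most k²
-- + 17k as k ≥ 1; 17/3 is rounded up to 6.
theorem18 = + 6 / 1 , λ k k≥1 →
  let t , ≤3t , 3t≤ = ceiling-third (potential (suc k)) in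
  t
  , winning⇒canForce
      (force k {N = 0} (ℕ.m≤m+n k 0) (record { present! = [] ; separate = [] ; bounded = [] }) []
        (affords (subst (potential (suc k) ≤_) (sym (ℕ.+-identityʳ (3 ℕ.* t))) ≤3t)))
  , fromℕ-≤-bound k 6 (total {t = t} k≥1 3t≤)
  where
  eq₁ : ∀ k → (1 ℕ.+ k) ℕ.* (1 ℕ.+ k) ℕ.+ 6 ℕ.* (1 ℕ.+ k) ℕ.+ 2
              ≡ k ℕ.* k ℕ.+ 8 ℕ.* k ℕ.+ 9 ℕ.* 1
  eq₁ = solve-∀
  eq₂ : ∀ k → k ℕ.* k ℕ.+ 8 ℕ.* k ℕ.+ 9 ℕ.* k ℕ.+ k
              ≡ k ℕ.* (k ℕ.* 1) ℕ.+ 3 ℕ.* (6 ℕ.* k)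
  eq₂ = solve-∀

  total : ∀ {k t} → k ≥ 1 → 3 ℕ.* t ≤ potential (suc k) ℕ.+ 2 →
          3 ℕ.* t ≤ k ^ 2 ℕ.+ 3 ℕ.* (6 ℕ.* k)
  total {k} {t} k≥1 3t≤ = begin
    3 ℕ.* t                                      ≤⟨ 3t≤ ⟩
    potential (suc k) ℕ.+ 2                      ≡⟨ eq₁ k ⟩
    k ℕ.* k ℕ.+ 8 ℕ.* k ℕ.+ 9 ℕ.* 1              ≤⟨ ℕ.+-monoʳ-≤ _ (ℕ.*-monoʳ-≤ 9 k≥1) ⟩
    k ℕ.* k ℕ.+ 8 ℕ.* k ℕ.+ 9 ℕ.* k              ≤⟨ ℕ.m≤m+n _ k ⟩
    k ℕ.* k ℕ.+ 8 ℕ.* k ℕ.+ 9 ℕ.* k ℕ.+ k        ≡⟨ eq₂ k ⟩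
    k ^ 2 ℕ.+ 3 ℕ.* (6 ℕ.* k)                    ∎
    where open ℕ.≤-Reasoning
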